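{- Let $k$ be a positive integer and let $U=\begin{bmatrix} 0 & 1 \\ -2^k & 2^k+1 \end{bmatrix}$. For every positive integer $n$, $$U^n=\begin{bmatrix} -2^kM_{n-1}^{(k)} & M_{n}^{(k)} \\ -2^k M_{n}^{(k)}& M_{n+1}^{(k)} \end{bmatrix}.$$
   Context: The Mersenne numbers $\{M_n\}_{n\ge 0}$ are defined by $M_0=0$, $M_1=1$, $M_{n+2}=3M_{n+1}-2M_n$, i.e. $M_n=2^n-1$. For a positive integer $k$, the higher order Mersenne numbers are $M_n^{(k)}=M_{kn}/M_k$ for $n=0,1,2,\dots$. -}

module Defs where

open import Algebra.Properties.Monoid.Sum using (sum)
open import Data.Bool using (if_then_else_)
open import Data.Fin using (Fin; _≟_)
open import Data.Integer as ℤ using (ℤ; +_; 0ℤ; 1ℤ)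
import Data.Integer.Properties as ℤ
open import Data.Integer.Tactic.RingSolver using (solve-∀)
open import Data.Nat as ℕ using (ℕ; zero; suc; NonZero)
import Data.Nat.Properties as ℕ
open import Data.Rational using (ℚ; 0ℚ; 1ℚ; _+_; _*_; _÷_; -_)
open import Data.Rational.Literals using (fromℤ)
open import Data.Rational.Properties using (+-0-monoid)
open import Data.Vec using (Vec; []; _∷_; lookup; tabulate)
open import Relation.Binary.PropositionalEquality using (_≡_; refl; sym; trans; cong; cong₂)
open import Relation.Nullary using (¬_; ⌊_⌋)

M : ℕ → ℤ
M zero          = 0ℤ
M (suc zero)    = 1ℤ
M (suc (suc n)) = + 3 ℤ.* M (suc n) ℤ.- + 2 ℤ.* M n

M-closed : ∀ n → M n ≡ (+ 2) ℤ.^ n ℤ.- 1ℤ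
M-closed zero          = refl
M-closed (suc zero)    = refl
M-closed (suc (suc n)) = trans
  (cong₂ (λ a b → + 3 ℤ.* a ℤ.- + 2 ℤ.* b) (M-closed (suc n)) (M-closed n))
  (step ((+ 2) ℤ.^ n))
  where
  step : ∀ x → + 3 ℤ.* (+ 2 ℤ.* x ℤ.- 1ℤ) ℤ.- + 2 ℤ.* (x ℤ.- 1ℤ)
             ≡ + 2 ℤ.* (+ 2 ℤ.* x) ℤ.- 1ℤ
  step = solve-∀

M-nonZero : ∀ k .{{_ : NonZero k}} → ℤ.NonZero (M k)
M-nonZero (suc k) = ℤ.≢-nonZero λ M≡0 → even≢1 ((+ 2) ℤ.^ k)
  (ℤ.i-j≡0⇒i≡j _ _ (trans (sym (M-closed (suc k))) M≡0))
  where
  even≢1 : ∀ x → ¬ (+ 2 ℤ.* x ≡ 1ℤ)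
  even≢1 x eq with ℕ.m*n≡1⇒m≡1 2 ℤ.∣ x ∣ (trans (sym (ℤ.abs-* (+ 2) x)) (cong ℤ.∣_∣ eq))
  ... | ()

-- The quotient is taken in ℚ, so that no rounding is involved.
M⁽_⁾ : (k : ℕ) .{{_ : NonZero k}} → ℕ → ℚ
M⁽ k ⁾ n = _÷_ (fromℤ (M (k ℕ.* n))) (fromℤ (M k)) {{M-nonZero k}}

Matrix : ℕ → ℕ → Set
Matrix m n = Vec (Vec ℚ n) m

matrix : ∀ {m n} → (Fin m → Fin n → ℚ) → Matrix m n
matrix f = tabulate λ i → tabulate (f i)

entry : ∀ {m n} → Matrix m n → Fin m → Fin n → ℚ
entry A i j = lookup (lookup A i) j

infixl 7 _⊗_
_⊗_ : ∀ {l m n} → Matrix l m → Matrix m n → Matrix l n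
A ⊗ B = matrix λ i j → sum +-0-monoid λ t → entry A i t * entry B t j

I : ∀ {n} → Matrix n n
I = matrix λ i j → if ⌊ i ≟ j ⌋ then 1ℚ else 0ℚ

infixr 8 _^^_
_^^_ : ∀ {n} → Matrix n n → ℕ → Matrix n n
A ^^ zero  = I
A ^^ suc n = A ⊗ A ^^ n

[_,_⨾_,_] : ℚ → ℚ → ℚ → ℚ → Matrix 2 2
[ a , b ⨾ c , d ] = (a ∷ b ∷ []) ∷ (c ∷ d ∷ []) ∷ []

2^ : ℕ → ℚ
2^ k = fromℤ ((+ 2) ℤ.^ k)

U : ℕ → Matrix 2 2
U k = [ 0ℚ     , 1ℚ
      ⨾ - 2^ k , 2^ k + 1ℚ ]

-- Both sides satisfy the same first-order recursion in n: multiplying by U on the left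
-- shifts the columns by the recurrence M⁽ᵏ⁾ₙ₊₂ = (2ᵏ + 1) M⁽ᵏ⁾ₙ₊₁ − 2ᵏ M⁽ᵏ⁾ₙ, which in
-- terms of x = 2ᵏ and y = 2ᵏⁿ is the identity
-- x²y − 1 = (x + 1)(xy − 1) − x(y − 1).
module Submission where

open import Defs
open import Data.Integer as ℤ using (+_; 1ℤ; -[1+_])
import Data.Integer.Properties as ℤ
open import Data.Integer.Tactic.RingSolver using (solve-∀)
open import Data.Nat as ℕ using (ℕ; zero; suc; pred; NonZero)
import Data.Nat.Properties as ℕ
open import Data.Rational using (0ℚ; 1ℚ; _+_; _*_; -_; 1/_)
open import Data.Rational.Literals using (fromℤ)
open import Data.Rational.Properties
  using (toℚᵘ-injective; toℚᵘ-homo-+; toℚᵘ-homo-*; *-inverseʳ; *-zeroˡ)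
open import Data.Rational.Solver using (module +-*-Solver)
import Data.Rational.Unnormalised as ℚᵘ
import Data.Rational.Unnormalised.Properties as ℚᵘ
open import Relation.Binary.PropositionalEquality
  using (_≡_; refl; sym; trans; cong; cong₂; module ≡-Reasoning)

open +-*-Solver using (solve; con; _:+_; _:*_; :-_; _:=_)

-- Addition in ℚ normalises its result by a gcd, which is stuck on variables. In ℚᵘ both sides have
-- denominator 1, and cross-multiplying leaves a ring identity in ℤ.
fromℤ-homo-+ : ∀ x y → fromℤ (x ℤ.+ y) ≡ fromℤ x + fromℤ y
fromℤ-homo-+ x y = toℚᵘ-injective
  (ℚᵘ.≃-trans (ℚᵘ.*≡* (lemma x y)) (ℚᵘ.≃-sym (toℚᵘ-homo-+ (fromℤ x) (fromℤ y))))
  where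
  lemma : ∀ x y → (x ℤ.+ y) ℤ.* 1ℤ ≡ (x ℤ.* 1ℤ ℤ.+ y ℤ.* 1ℤ) ℤ.* 1ℤ
  lemma = solve-∀

fromℤ-homo-* : ∀ x y → fromℤ (x ℤ.* y) ≡ fromℤ x * fromℤ y
fromℤ-homo-* x y = toℚᵘ-injective
  (ℚᵘ.≃-trans (ℚᵘ.*≡* refl) (ℚᵘ.≃-sym (toℚᵘ-homo-* (fromℤ x) (fromℤ y))))

fromℤ-homo‿- : ∀ x → fromℤ (ℤ.- x) ≡ - fromℤ x
-- Negation in ℚ matches on the sign of the numerator, so it computes only after this split.
fromℤ-homo‿- (+ zero)  = refl
fromℤ-homo‿- (+ suc _) = refl
fromℤ-homo‿- -[1+ _ ]  = refl

-- This is the recurrence with the common denominator `M k` cleared, so that the closed form and the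
-- ring solver can be used in ℤ.
M-recurrence : ∀ k n →
  M (k ℕ.* suc (suc n))
    ≡ ((+ 2) ℤ.^ k ℤ.+ 1ℤ) ℤ.* M (k ℕ.* suc n) ℤ.+ ℤ.- (+ 2) ℤ.^ k ℤ.* M (k ℕ.* n)
M-recurrence k n = begin
  M (k ℕ.* suc (suc n))
    ≡⟨ M-closed (k ℕ.* suc (suc n)) ⟩
  (+ 2) ℤ.^ (k ℕ.* suc (suc n)) ℤ.- 1ℤ
    ≡⟨ cong (ℤ._- 1ℤ) (trans (^-*-suc (suc n)) (cong (x ℤ.*_) (^-*-suc n))) ⟩
  x ℤ.* (x ℤ.* y) ℤ.- 1ℤ
    ≡⟨ identity x y ⟩
  (x ℤ.+ 1ℤ) ℤ.* (x ℤ.* y ℤ.- 1ℤ) ℤ.+ ℤ.- x ℤ.* (y ℤ.- 1ℤ)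
    ≡⟨ cong₂ (λ a b → (x ℤ.+ 1ℤ) ℤ.* a ℤ.+ ℤ.- x ℤ.* b)
         (trans (M-closed (k ℕ.* suc n)) (cong (ℤ._- 1ℤ) (^-*-suc n)))
         (M-closed (k ℕ.* n)) ⟨
  (x ℤ.+ 1ℤ) ℤ.* M (k ℕ.* suc n) ℤ.+ ℤ.- x ℤ.* M (k ℕ.* n) ∎
  where
  open ≡-Reasoning
  x = (+ 2) ℤ.^ k
  y = (+ 2) ℤ.^ (k ℕ.* n)

  ^-*-suc : ∀ m → (+ 2) ℤ.^ (k ℕ.* suc m) ≡ x ℤ.* (+ 2) ℤ.^ (k ℕ.* m)
  ^-*-suc m = trans (cong ((+ 2) ℤ.^_) (ℕ.*-suc k m)) (ℤ.^-distribˡ-+-* (+ 2) k (k ℕ.* m))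

  identity : ∀ x y → x ℤ.* (x ℤ.* y) ℤ.- 1ℤ
    ≡ (x ℤ.+ 1ℤ) ℤ.* (x ℤ.* y ℤ.- 1ℤ) ℤ.+ ℤ.- x ℤ.* (y ℤ.- 1ℤ)
  identity = solve-∀

[]-cong : ∀ {a a′ b b′ c c′ d d′} → a ≡ a′ → b ≡ b′ → c ≡ c′ → d ≡ d′ →
  [ a , b ⨾ c , d ] ≡ [ a′ , b′ ⨾ c′ , d′ ]
[]-cong refl refl refl refl = refl

module _ (k : ℕ) .{{_ : NonZero k}} where

  private
    q = 2^ k

  M⁽⁾-zero : M⁽ k ⁾ 0 ≡ 0ℚ
  M⁽⁾-zero = trans (cong (λ m → fromℤ (M m) * r) (ℕ.*-zeroʳ k)) (*-zeroˡ r)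
    where r = 1/_ (fromℤ (M k)) {{M-nonZero k}}

  M⁽⁾-one : M⁽ k ⁾ 1 ≡ 1ℚ
  M⁽⁾-one = trans
    (cong (λ m → fromℤ (M m) * 1/_ (fromℤ (M k)) {{M-nonZero k}}) (ℕ.*-identityʳ k))
    (*-inverseʳ (fromℤ (M k)) {{M-nonZero k}})

  -- The integer recurrence is linear in the values of `M`, so the factor `r`, the inverse of `M k`,
  -- distributes over it.
  M⁽⁾-recurrence : ∀ n → M⁽ k ⁾ (suc (suc n)) ≡ (q + 1ℚ) * M⁽ k ⁾ (suc n) + - q * M⁽ k ⁾ n
  M⁽⁾-recurrence n = begin
    fromℤ (M (k ℕ.* suc (suc n))) * r
      ≡⟨ cong (λ m → fromℤ m * r) (M-recurrence k n) ⟩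
    fromℤ ((x ℤ.+ 1ℤ) ℤ.* a ℤ.+ ℤ.- x ℤ.* b) * r
      ≡⟨ cong (_* r) (fromℤ-homo-+ ((x ℤ.+ 1ℤ) ℤ.* a) (ℤ.- x ℤ.* b)) ⟩
    (fromℤ ((x ℤ.+ 1ℤ) ℤ.* a) + fromℤ (ℤ.- x ℤ.* b)) * r
      ≡⟨ cong₂ (λ s t → (s + t) * r)
           (trans (fromℤ-homo-* (x ℤ.+ 1ℤ) a) (cong (_* fromℤ a) (fromℤ-homo-+ x 1ℤ)))
           (trans (fromℤ-homo-* (ℤ.- x) b) (cong (_* fromℤ b) (fromℤ-homo‿- x))) ⟩
    ((q + 1ℚ) * fromℤ a + - q * fromℤ b) * r
      ≡⟨ solve 4 (λ q a b r → ((q :+ con 1ℚ) :* a :+ :- q :* b) :* r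
                   := (q :+ con 1ℚ) :* (a :* r) :+ :- q :* (b :* r))
               refl q (fromℤ a) (fromℤ b) r ⟩
    (q + 1ℚ) * (fromℤ a * r) + - q * (fromℤ b * r) ∎
    where
    open ≡-Reasoning
    x = (+ 2) ℤ.^ k
    a = M (k ℕ.* suc n)
    b = M (k ℕ.* n)
    r = 1/_ (fromℤ (M k)) {{M-nonZero k}}

  U⊗ : ∀ a b c d → U k ⊗ [ a , b ⨾ c , d ]
    ≡ [ c , d ⨾ (q + 1ℚ) * c + - q * a , (q + 1ℚ) * d + - q * b ]
  U⊗ a b c d = []-cong (top a c) (top b d) (bottom a c) (bottom b d)
    where
    -- The final `0ℚ` is the empty sum that ends `sum` over two indices.
    top : ∀ s t → 0ℚ * s + (1ℚ * t + 0ℚ) ≡ t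
    top = solve 2 (λ s t → con 0ℚ :* s :+ (con 1ℚ :* t :+ con 0ℚ) := t) refl

    bottom : ∀ s t → - q * s + ((q + 1ℚ) * t + 0ℚ) ≡ (q + 1ℚ) * t + - q * s
    bottom = solve 3 (λ q s t → :- q :* s :+ ((q :+ con 1ℚ) :* t :+ con 0ℚ)
                        := (q :+ con 1ℚ) :* t :+ :- q :* s) refl q

  -- Stating the result for exponent `suc n` avoids the predecessor index and starts the induction
  -- at exponent 1.
  U^^suc : ∀ n → U k ^^ suc n ≡ [ - q * M⁽ k ⁾ n       , M⁽ k ⁾ (suc n)
                                ⨾ - q * M⁽ k ⁾ (suc n) , M⁽ k ⁾ (suc (suc n)) ]
  -- The first power unfolds to `U k ⊗ I`, hence the entries of the identity matrix.
  U^^suc zero = trans (U⊗ 1ℚ 0ℚ 0ℚ 1ℚ) ([]-cong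
    (sym (trans (cong (- q *_) M⁽⁾-zero) (-q*0 q)))
    (sym M⁽⁾-one)
    (trans (bottomˡ q) (cong (- q *_) (sym M⁽⁾-one)))
    (sym (trans (M⁽⁾-recurrence 0)
      (cong₂ (λ s t → (q + 1ℚ) * s + - q * t) M⁽⁾-one M⁽⁾-zero))))
    where
    -q*0 : ∀ q → - q * 0ℚ ≡ 0ℚ
    -q*0 = solve 1 (λ q → :- q :* con 0ℚ := con 0ℚ) refl

    bottomˡ : ∀ q → (q + 1ℚ) * 0ℚ + - q * 1ℚ ≡ - q * 1ℚ
    bottomˡ = solve 1 (λ q → (q :+ con 1ℚ) :* con 0ℚ :+ :- q :* con 1ℚ := :- q :* con 1ℚ) refl
  U^^suc (suc n) = trans (cong (U k ⊗_) (U^^suc n)) (trans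
    (U⊗ (- q * m₀) m₁ (- q * m₁) m₂)
    -- The new top row is the old bottom row verbatim. In the bottom row the right entry is the
    -- recurrence itself, and the left entry is the recurrence one index lower once `- q` is
    -- factored out.
    ([]-cong refl refl
      (trans (factor q m₀ m₁) (cong (- q *_) (sym (M⁽⁾-recurrence n))))
      (sym (M⁽⁾-recurrence (suc n)))))
    where
    m₀ = M⁽ k ⁾ n
    m₁ = M⁽ k ⁾ (suc n)
    m₂ = M⁽ k ⁾ (suc (suc n))

    factor : ∀ q a b → (q + 1ℚ) * (- q * b) + - q * (- q * a) ≡ - q * ((q + 1ℚ) * b + - q * a)
    factor = solve 3 (λ q a b → (q :+ con 1ℚ) :* (:- q :* b) :+ :- q :* (:- q :* a)
                        := :- q :* ((q :+ con 1ℚ) :* b :+ :- q :* a)) refl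

theorem3p1 : (k : ℕ) .{{_ : NonZero k}} (n : ℕ) .{{_ : NonZero n}} →
    U k ^^ n ≡ [ - 2^ k * M⁽ k ⁾ (pred n) , M⁽ k ⁾ n
    ⨾ - 2^ k * M⁽ k ⁾ n        , M⁽ k ⁾ (suc n) ]
theorem3p1 k (suc n) = U^^suc k n
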